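{- Let $\mathcal{A}_0=(A_0,\mathcal{F}_0)$ and $\mathcal{A}_1=(A_1,\mathcal{F}_1)$ be algebras of the same language that are isomorphic. Then $\mathcal{A}_0$ is a Ramsey algebra if and only if $\mathcal{A}_1$ is a Ramsey algebra.
   Context: An algebra $\mathcal{A}=(A,\mathcal{F})$ consists of a set $A$ and a family $\mathcal{F}$ of finitary operations $f:A^n\to A$ on $A$. When $\mathcal{L}$ is a set of function symbols (a purely functional language), an algebra of the language $\mathcal{L}$ is an $\mathcal{L}$-structure, $\mathcal{F}$ being the family of interpretations of the symbols; isomorphism is isomorphism of $\mathcal{L}$-structures. An $n$-ary $f$ is an orderly composition of a family $\mathcal{G}$ of operations if there are a $k$-ary $g\in\mathcal{G}$ and $n_j$-ary $h_j\in\mathcal{G}$ ($1\le j\le k$) with $\sum_{j=1}^k n_j=n$ such that $f(x_1,\dots,x_n)=g(h_1(\bar x_1),\dots,h_k(\bar x_k))$, where $\bar x_1,\dots,\bar x_k$ are the consecutive blocks of $(x_1,\dots,x_n)$ of lengths $n_1,\dots,n_k$. The set $\mathrm{OT}(\mathcal{F})$ of orderly terms over $\mathcal{F}$ is the smallest collection of operations on $A$ that contains $\mathcal{F}\cup\{\mathrm{id}_A\}$ and is closed under orderly composition. For infinite sequences $\vec a,\vec b\in{}^\omega A$, $\vec a$ is a reduction of $\vec b$, written $\vec a\le_{\mathcal{F}}\vec b$, if there are orderly terms $f_j\in\mathrm{OT}(\mathcal{F})$ and finite subsequences $\vec b_j$ of $\vec b$ ($j\in\omega$) such that $\vec a(j)=f_j(\vec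 b_j)$ for every $j$ and the concatenation $\vec b_0*\vec b_1*\cdots$ is a subsequence of $\vec b$. Put $\mathrm{FR}_{\mathcal{F}}(\vec b)=\{\vec a(0):\vec a\le_{\mathcal{F}}\vec b\}$. The algebra $(A,\mathcal{F})$ is a Ramsey algebra if for every $\vec b\in{}^\omega A$ and every $X\subseteq A$ there is $\vec a\le_{\mathcal{F}}\vec b$ such that $\mathrm{FR}_{\mathcal{F}}(\vec a)$ is either contained in $X$ or disjoint from $X$. -}

module Defs where

open import Data.Fin as Fin using (Fin; zero; suc)
open import Data.Nat as ℕ using (ℕ)
open import Data.Product using (Σ; ∃-syntax; _×_; _,_; uncurry)
open import Data.Sum using (_⊎_)
open import Data.Vec using (Vec; []; _∷_; head; lookup; map; sum; tabulate; take; drop)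
open import Function.Bundles using (_⤖_; module Bijection)
open import Level using (Level; _⊔_) renaming (suc to lsuc)
open import Relation.Binary.Core using (Rel; _Preserves_⟶_)
open import Relation.Binary.PropositionalEquality using (_≡_; _≗_)
open import Relation.Unary using (Pred; _⊆_; _⊥_)

private variable
  a a₀ a₁ s ℓ ℓ′ i r : Level

Op : Set a → ℕ → Set a
Op A n = Vec A n → A

-- In the absence of function extensionality, f = g for operations is read as
-- f ≗ g; this is why the constructors below that describe an operation take
-- an f together with a proof that it has the prescribed values.
OpFamily : Set a → (ℓ : Level) → Set (a ⊔ lsuc ℓ)
OpFamily A ℓ = ∀ n → Pred (Op A n) ℓ

blocks : {A : Set a} {k : ℕ} (ns : Vec ℕ k) →
         Vec A (sum ns) → (j : Fin k) → Vec A (lookup ns j)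
blocks (n ∷ ns) xs zero    = take n xs
blocks (n ∷ ns) xs (suc j) = blocks ns (drop n xs) j

data IsOrderlyComposition {A : Set a} (𝒢 : OpFamily A ℓ) :
                          OpFamily A (a ⊔ ℓ) where
  compose : ∀ {k} (g : Op A k) → 𝒢 k g →
            (ns : Vec ℕ k) (h : ∀ j → Op A (lookup ns j)) →
            (∀ j → 𝒢 (lookup ns j) (h j)) →
            (f : Op A (sum ns)) →
            (∀ xs → f xs ≡ g (tabulate λ j → h j (blocks ns xs j))) →
            IsOrderlyComposition 𝒢 (sum ns) f

data OT {A : Set a} (ℱ : OpFamily A ℓ) : OpFamily A (a ⊔ ℓ) where
  basic    : ∀ {n} {f : Op A n} → ℱ n f → OT ℱ n f
  identity : {f : Op A 1} → f ≗ head → OT ℱ 1 f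
  composed : ∀ {n} {f : Op A n} → IsOrderlyComposition (OT ℱ) n f → OT ℱ n f

-- A sequence (finite or infinite) is a function out of a strictly ordered
-- index type; it is a subsequence of b when it reads off b along strictly
-- increasing indices.
IsSubsequence : {A : Set a} {I : Set i} (_<_ : Rel I r) →
                (I → A) → (ℕ → A) → Set (a ⊔ i ⊔ r)
IsSubsequence _<_ c b =
  ∃[ e ] e Preserves _<_ ⟶ ℕ._<_ × (∀ p → c p ≡ b (e p))

-- The concatenation x₀ * x₁ * ⋯ is indexed by pairs (j , p), standing for the
-- p-th entry of x_j, in lexicographic order.  Indexing by ℕ instead would
-- exclude the case where all but finitely many blocks are empty, which can
-- occur when there are nullary operations.
Position : (ℕ → ℕ) → Set
Position n = Σ ℕ λ j → Fin (n j)

data _<ₚ_ {n : ℕ → ℕ} : Rel (Position n) Level.zero where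
  earlier-block : ∀ {j j′ p p′} → j ℕ.< j′ → (j , p) <ₚ (j′ , p′)
  same-block    : ∀ {j p p′} → p Fin.< p′ → (j , p) <ₚ (j , p′)

concatenation : {A : Set a} {n : ℕ → ℕ} → (∀ j → Vec A (n j)) → Position n → A
concatenation xs = uncurry λ j → lookup (xs j)

record Reduction {A : Set a} (ℱ : OpFamily A ℓ) (α β : ℕ → A) : Set (a ⊔ ℓ) where
  field
    arities : ℕ → ℕ
    terms   : ∀ j → Op A (arities j)
    orderly : ∀ j → OT ℱ (arities j) (terms j)
    args    : ∀ j → Vec A (arities j)
    args-subsequence : ∀ j → IsSubsequence Fin._<_ (lookup (args j)) β
    values  : ∀ j → α j ≡ terms j (args j)
    concatenation-subsequence : IsSubsequence _<ₚ_ (concatenation args) β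

FR : {A : Set a} → OpFamily A ℓ → (ℕ → A) → Pred A (a ⊔ ℓ)
FR ℱ β x = ∃[ α ] Reduction ℱ α β × α 0 ≡ x

-- ℓ′ is the universe level of the subsets X ⊆ A.
IsRamsey : (ℓ′ : Level) {A : Set a} → OpFamily A ℓ → Set (a ⊔ ℓ ⊔ lsuc ℓ′)
IsRamsey ℓ′ {A} ℱ =
  (β : ℕ → A) (X : Pred A ℓ′) →
  ∃[ α ] Reduction ℱ α β × (FR ℱ α ⊆ X ⊎ FR ℱ α ⊥ X)

record Language (s : Level) : Set (lsuc s) where
  field
    Symbol : Set s
    arity  : Symbol → ℕ

record Algebra (L : Language s) (a : Level) : Set (s ⊔ lsuc a) where
  open Language L
  field
    Carrier : Set a
    interp  : (σ : Symbol) → Op Carrier (arity σ)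

data Operations {L : Language s} (𝒜 : Algebra L a) :
                OpFamily (Algebra.Carrier 𝒜) (s ⊔ a) where
  interpretation : (σ : Language.Symbol L)
                   {f : Op (Algebra.Carrier 𝒜) (Language.arity L σ)} →
                   f ≗ Algebra.interp 𝒜 σ →
                   Operations 𝒜 (Language.arity L σ) f

RamseyAlgebra : (ℓ : Level) {L : Language s} → Algebra L a → Set (s ⊔ a ⊔ lsuc ℓ)
RamseyAlgebra ℓ 𝒜 = IsRamsey ℓ (Operations 𝒜)

record _≅_ {L : Language s} (𝒜₀ : Algebra L a₀) (𝒜₁ : Algebra L a₁) :
           Set (s ⊔ a₀ ⊔ a₁) where
  private
    module 𝒜₀ = Algebra 𝒜₀
    module 𝒜₁ = Algebra 𝒜₁
  field
    bijection : 𝒜₀.Carrier ⤖ 𝒜₁.Carrier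
  open Bijection bijection public using (to)
  field
    homo : ∀ σ xs → to (𝒜₀.interp σ xs) ≡ 𝒜₁.interp σ (map to xs)

{-# OPTIONS --safe #-}

-- An isomorphism φ conjugates the operations of 𝒜₀ into those of 𝒜₁, and
-- hence orderly terms, reductions and FR sets as well.  Since φ⁻¹ does the
-- same in the other direction, a sequence homogeneous for φ⁻¹(X) is sent by φ
-- to a sequence homogeneous for X.
module Submission where

open import Defs
open import Data.Fin using (Fin; zero; suc)
open import Data.Nat using (ℕ)
open import Data.Product using (_,_; uncurry)
import Data.Sum as Sum
open import Data.Vec using (Vec; []; _∷_; lookup; map; tabulate; sum)
open import Data.Vec.Properties
  using (map-cong; map-id; map-∘; lookup-map; tabulate-cong; tabulate-∘; take-map; drop-map)
open import Function.Base using (_∘_)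
open import Function.Bundles using (_⇔_; _↔_; mk⇔; module Inverse)
open import Function.Properties.Bijection using (⤖⇒↔)
open import Function.Properties.Inverse using (↔-sym)
open import Level using (Level)
open import Relation.Binary.Core using (Rel)
open import Relation.Binary.PropositionalEquality

private variable
  a b i r ℓ ℓ₁ ℓ₂ : Level
  A : Set a
  B : Set b

blocks-map : (f : A → B) {k : ℕ} (ns : Vec ℕ k) (xs : Vec A (sum ns)) (j : Fin k) →
             blocks ns (map f xs) j ≡ map f (blocks ns xs j)
blocks-map f (n ∷ ns) xs zero    = take-map f n xs
blocks-map f (n ∷ ns) xs (suc j) =
  trans (cong (λ ys → blocks ns ys j) (drop-map f n xs)) (blocks-map f ns _ j)

-- The index embedding `e` is reused unchanged. The order on `I` is left arbitrary so that one lemma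
-- serves both a single block and the lexicographically ordered concatenation.
IsSubsequence-map : {I : Set i} {_<_ : Rel I r} (f : A → B)
                    {c : I → A} {c′ : I → B} {β : ℕ → A} {β′ : ℕ → B} →
                    c′ ≗ f ∘ c → β′ ≗ f ∘ β →
                    IsSubsequence _<_ c β → IsSubsequence _<_ c′ β′
IsSubsequence-map f c′≗ β′≗ (e , e-mono , c≡β∘e) =
  e , e-mono , λ p → trans (c′≗ p) (trans (cong f (c≡β∘e p)) (sym (β′≗ (e p))))

map-inverse : {f : A → B} {g : B → A} → (∀ x → g (f x) ≡ x) →
              ∀ {n} (xs : Vec A n) → map g (map f xs) ≡ xs
map-inverse {f = f} {g = g} g∘f≗id xs =
  trans (sym (map-∘ g f xs)) (trans (map-cong g∘f≗id xs) (map-id xs))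

module _ {A : Set a} {B : Set b} (φ : A ↔ B) where
  open Inverse φ using (to; from; strictlyInverseˡ; strictlyInverseʳ)

  -- The operation that `φ` must carry `f` to in order to be a homomorphism; `conjugate-map` is that
  -- homomorphism law.
  conjugate : ∀ {n} → Op A n → Op B n
  conjugate f = to ∘ f ∘ map from

  Transports : OpFamily A ℓ₁ → OpFamily B ℓ₂ → Set _
  Transports ℱ 𝒢 = ∀ {n} {f : Op A n} → ℱ n f → 𝒢 n (conjugate f)

  conjugate-map : ∀ {n} (f : Op A n) xs → conjugate f (map to xs) ≡ to (f xs)
  conjugate-map f xs = cong (to ∘ f) (map-inverse strictlyInverseʳ xs)

  module _ {ℱ : OpFamily A ℓ₁} {𝒢 : OpFamily B ℓ₂} (transport : Transports ℱ 𝒢) where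

    -- Induction on the orderly term. Conjugation commutes with composition because the `from`
    -- entering the outer operation cancels the `to` leaving the inner ones.
    OT-transport : Transports (OT ℱ) (OT 𝒢)
    OT-transport (basic ℱf) = basic (transport ℱf)
    OT-transport (identity {f} f≗head) = identity conjugate≗head
      where
      conjugate≗head : conjugate f ≗ _
      conjugate≗head (x ∷ []) = trans (cong to (f≗head _)) (strictlyInverseˡ x)
    OT-transport (composed (compose g g∈OT ns h h∈OT f f≡)) =
      composed (compose (conjugate g) (OT-transport g∈OT)
                        ns (conjugate ∘ h) (OT-transport ∘ h∈OT) (conjugate f) conjugate≡)
      where
      open ≡-Reasoning
      conjugate≡ : ∀ xs → conjugate f xs ≡
                          conjugate g (tabulate λ j → conjugate (h j) (blocks ns xs j))
      conjugate≡ xs = begin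
        to (f (map from xs))
          ≡⟨ cong to (f≡ (map from xs)) ⟩
        to (g (tabulate λ j → h j (blocks ns (map from xs) j)))
          ≡⟨ cong (to ∘ g) (tabulate-cong λ j → cong (h j) (blocks-map from ns xs j)) ⟩
        to (g (tabulate λ j → h j (map from (blocks ns xs j))))
          -- Read backwards, this inserts the cancelling pair `from`, `to` between `g` and the inner
          -- operations.
          ≡⟨ conjugate-map g _ ⟨
        conjugate g (map to (tabulate λ j → h j (map from (blocks ns xs j))))
          ≡⟨ cong (conjugate g) (tabulate-∘ to _) ⟨
        conjugate g (tabulate λ j → conjugate (h j) (blocks ns xs j)) ∎

    -- Only pointwise agreement with `to ∘ β` is asked of `β′`, since the lemma is applied to
    -- sequences that are such an image merely after cancelling a round trip through `φ`.
    Reduction-transport : ∀ {α β β′} → β′ ≗ to ∘ β →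
                          Reduction ℱ α β → Reduction 𝒢 (to ∘ α) β′
    Reduction-transport β′≗ ρ = record
      { arities = arities
      ; terms   = conjugate ∘ terms
      ; orderly = OT-transport ∘ orderly
      ; args    = map to ∘ args
      ; args-subsequence = λ j →
          IsSubsequence-map to (λ p → lookup-map p to (args j)) β′≗ (args-subsequence j)
      ; values  = λ j → trans (cong to (values j)) (sym (conjugate-map (terms j) (args j)))
      ; concatenation-subsequence =
          IsSubsequence-map to (uncurry λ j p → lookup-map p to (args j)) β′≗
                            concatenation-subsequence
      }
      where open Reduction ρ

    FR-transport : ∀ {β β′ x} → β′ ≗ to ∘ β → FR ℱ β x → FR 𝒢 β′ (to x)
    FR-transport β′≗ (α , ρ , α₀≡x) = to ∘ α , Reduction-transport β′≗ ρ , cong to α₀≡x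

IsRamsey-transport : {A : Set a} {B : Set b} (φ : A ↔ B)
                     {ℱ : OpFamily A ℓ₁} {𝒢 : OpFamily B ℓ₂} →
                     Transports φ ℱ 𝒢 → Transports (↔-sym φ) 𝒢 ℱ →
                     IsRamsey ℓ ℱ → IsRamsey ℓ 𝒢
IsRamsey-transport φ {ℱ} {𝒢} φ-transport φ⁻¹-transport ramsey β X
  with ramsey (Inverse.from φ ∘ β) (X ∘ Inverse.to φ)
... | α , α≤β , homogeneous =
  to ∘ α , Reduction-transport φ φ-transport (λ n → sym (strictlyInverseˡ (β n))) α≤β ,
  Sum.map
    -- Homogeneity speaks of `to (from x)`, which is carried back to `x`.
    (λ FR⊆X {_} x∈FR → subst X (strictlyInverseˡ _) (FR⊆X (pullback x∈FR)))
    (λ FR⊥X {_} (x∈FR , x∈X) →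
      FR⊥X (pullback x∈FR , subst X (sym (strictlyInverseˡ _)) x∈X))
    homogeneous
  where
  open Inverse φ using (to; from; strictlyInverseˡ; strictlyInverseʳ)
  -- Homogeneity is known for `α`, so reductions of `to ∘ α` have to return along the inverse; this
  -- is where the second transport enters.
  pullback : ∀ {x} → FR 𝒢 (to ∘ α) x → FR ℱ α (from x)
  pullback = FR-transport (↔-sym φ) φ⁻¹-transport (λ n → sym (strictlyInverseʳ (α n)))

module _ {s a₀ a₁ : Level} {L : Language s} {𝒜₀ : Algebra L a₀} {𝒜₁ : Algebra L a₁}
         (iso : 𝒜₀ ≅ 𝒜₁) where
  open _≅_ iso using (bijection; homo)
  open Algebra using (interp)

  private φ = ⤖⇒↔ bijection
  open Inverse φ using (to; from; strictlyInverseˡ; strictlyInverseʳ)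

  Operations-to : Transports φ (Operations 𝒜₀) (Operations 𝒜₁)
  Operations-to (interpretation σ f≗σ) = interpretation σ λ xs →
    trans (cong to (f≗σ _))
      (trans (homo σ _) (cong (interp 𝒜₁ σ) (map-inverse strictlyInverseˡ xs)))

  -- The inverse of a bijective homomorphism is again one: `homo` is read from right to left and
  -- `from` then cancels `to`.
  Operations-from : Transports (↔-sym φ) (Operations 𝒜₁) (Operations 𝒜₀)
  Operations-from (interpretation σ f≗σ) = interpretation σ λ xs →
    trans (cong from (trans (f≗σ _) (sym (homo σ xs)))) (strictlyInverseʳ _)

corollary3p2 : ∀ {s a₀ a₁ : Level} (ℓ : Level) (L : Language s)
    (𝒜₀ : Algebra L a₀) (𝒜₁ : Algebra L a₁) →
    𝒜₀ ≅ 𝒜₁ →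
    RamseyAlgebra ℓ 𝒜₀ ⇔ RamseyAlgebra ℓ 𝒜₁
corollary3p2 ℓ L 𝒜₀ 𝒜₁ iso = mk⇔
  (IsRamsey-transport φ (Operations-to iso) (Operations-from iso))
  -- Inverting `φ` twice restores `to` and `from` definitionally, so the two transports simply
  -- exchange roles.
  (IsRamsey-transport (↔-sym φ) (Operations-from iso) (Operations-to iso))
  where φ = ⤖⇒↔ (_≅_.bijection iso)
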